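{- Let $V$ be a finite set with $|V|\geq 3$. Then for every Boolean sublattice $\mathcal{B}$ of $\mathrm{Part}(V)$ of largest size among all Boolean sublattices of $\mathrm{Part}(V)$ there is a semi-interval system $(V,\mathcal{I})$ such that $\mathcal{B}=\mathcal{D}(V,\mathcal{I})$.
   Context: $\mathrm{Part}(V)$ is the lattice of all partitions of $V$ ordered by refinement. A Boolean sublattice is a sublattice (closed under meet and join of $\mathrm{Part}(V)$) that is itself a Boolean lattice. A closure system $(V,\mathcal{Q})$ is a family $\mathcal{Q}\subseteq\wp(V)$ containing $V$ and closed under arbitrary intersections. A semi-interval system is a closure system $(V,\mathcal{I})$ satisfying: (I$_0$) $\emptyset\in\mathcal{I}$ and $\{x\}\in\mathcal{I}$ for all $x\in V$; (I$_1$) if $A,B\in\mathcal{I}$ and $A\cap B\neq\emptyset$, then $A\cup B\in\mathcal{I}$. $\mathcal{D}(V,\mathcal{I})$ is the set of all partitions of $V$ all of whose blocks belong to $\mathcal{I}$, ordered by refinement. -}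

module Defs where

open import Level using (Level; 0ℓ; suc; _⊔_)
open import Data.Fin.Base using (Fin)
open import Data.Fin.Properties using (all?)
open import Data.Fin.Subset using (Subset; inside; _∈_; _∉_; _⊆_; _∩_; _∪_; ∁; ⊤; ⊥; ⁅_⁆; Nonempty; ⋂)
open import Data.Fin.Subset.Properties
  using (_∈?_; _⊆?_; anySubset?; ⊆-antisym; x∈p∩q⁺; x∈p∩q⁻; p∩q⊆p; p∩q⊆q; x∈p⇒x∉∁p; x∈∁p⇒x∉p; x∉p⇒x∈∁p)
open import Data.List.Base using (List)
open import Data.List.Relation.Unary.All using (All)
open import Data.Nat.Base using (ℕ; _≤_)
open import Data.Product using (∃; _×_; _,_; proj₁; proj₂)
open import Data.Vec.Base using (tabulate)
open import Data.Vec.Properties using (lookup∘tabulate; []=⇒lookup; lookup⇒[]=)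
open import Function.Base using (_on_)
open import Function.Bundles using (Inverse)
open import Algebra.Core using (Op₁; Op₂)
open import Algebra.Lattice.Structures using (IsBooleanAlgebra)
open import Relation.Binary.Bundles using (Setoid)
open import Relation.Binary.Core using (Rel)
open import Relation.Binary.Definitions using (_Respects_)
open import Relation.Binary.Lattice using (Lattice; Infimum)
open import Relation.Binary.PropositionalEquality using (_≡_; refl; sym; trans; subst; setoid)
open import Relation.Binary.Structures using (IsPartialOrder)
import Relation.Binary.Construct.On as On
open import Relation.Nullary using (¬_; Dec; yes; no; does; contradiction)
open import Relation.Nullary.Decidable using (map′; _×-dec_; _→-dec_; ¬?; decidable-stable; dec-true)
open import Relation.Unary using (Pred; Decidable; _≐_) renaming (_⊆_ to _⊆ₚ_)
open import Relation.Unary.Properties using (≐-refl; ≐-sym; ≐-trans)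

private
  variable
    n : ℕ

-- The finite set V is Fin n, and ℘(V) is Subset n.

------------------------------------------------------------------------
-- The lattice Part(V)

record Partition (n : ℕ) : Set₁ where
  field
    Block    : Pred (Subset n) 0ℓ
    nonempty : ∀ {A} → Block A → Nonempty A
    disjoint : ∀ {A B x} → Block A → Block B → x ∈ A → x ∈ B → A ≡ B
    covers   : ∀ x → ∃ λ A → Block A × x ∈ A

  block : Fin n → Subset n
  block x = proj₁ (covers x)

  block-isBlock : ∀ x → Block (block x)
  block-isBlock x = proj₁ (proj₂ (covers x))

  x∈block : ∀ x → x ∈ block x
  x∈block x = proj₂ (proj₂ (covers x))

open Partition

infix 4 _≈ₚ_ _≤ₚ_

_≈ₚ_ : Rel (Partition n) 0ℓ
π ≈ₚ σ = Block π ≐ Block σ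

_≤ₚ_ : Rel (Partition n) 0ℓ
π ≤ₚ σ = ∀ {A} → Block π A → ∃ λ B → Block σ B × A ⊆ B

private
  ≤ₚ-antisym₁ : (π σ : Partition n) → π ≤ₚ σ → σ ≤ₚ π → Block π ⊆ₚ Block σ
  ≤ₚ-antisym₁ π σ π≤σ σ≤π {A} a
    with B , b , A⊆B ← π≤σ a
    with C , c , B⊆C ← σ≤π b
    with x , x∈A ← nonempty π a
    with refl ← disjoint π a c x∈A (B⊆C (A⊆B x∈A))
    = subst (Block σ) (⊆-antisym B⊆C A⊆B) b

≤ₚ-isPartialOrder : IsPartialOrder {A = Partition n} _≈ₚ_ _≤ₚ_
≤ₚ-isPartialOrder = record
  { isPreorder = record
    { isEquivalence = record { refl = ≐-refl ; sym = ≐-sym ; trans = ≐-trans }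
    ; reflexive     = λ π≈σ {A} a → A , proj₁ π≈σ a , λ x∈A → x∈A
    ; trans         = λ π≤σ σ≤ρ a →
        let B , b , A⊆B = π≤σ a
            C , c , B⊆C = σ≤ρ b
        in C , c , λ x∈A → B⊆C (A⊆B x∈A)
    }
  ; antisym = λ {π} {σ} π≤σ σ≤π → ≤ₚ-antisym₁ π σ π≤σ σ≤π , ≤ₚ-antisym₁ σ π σ≤π π≤σ
  }

infixr 7 _∧ₚ_

_∧ₚ_ : Op₂ (Partition n)
π ∧ₚ σ = record
  { Block    = λ C → Nonempty C × ∃ λ A → ∃ λ B → Block π A × Block σ B × C ≡ A ∩ B
  ; nonempty = proj₁
  ; disjoint = λ where
      (_ , A , B , a , b , refl) (_ , A′ , B′ , a′ , b′ , refl) x∈C x∈C′ →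
        let x∈A  , x∈B  = x∈p∩q⁻ A  B  x∈C
            x∈A′ , x∈B′ = x∈p∩q⁻ A′ B′ x∈C′
        in ∩-≡ (disjoint π a a′ x∈A x∈A′) (disjoint σ b b′ x∈B x∈B′)
  ; covers   = λ x →
      let x∈C = x∈p∩q⁺ (x∈block π x , x∈block σ x) in
      block π x ∩ block σ x ,
      ((x , x∈C) , block π x , block σ x , block-isBlock π x , block-isBlock σ x , refl) ,
      x∈C
  }
  where
  ∩-≡ : ∀ {A A′ B B′ : Subset n} → A ≡ A′ → B ≡ B′ → A ∩ B ≡ A′ ∩ B′
  ∩-≡ refl refl = refl

∧ₚ-infimum : Infimum {A = Partition n} _≤ₚ_ _∧ₚ_
∧ₚ-infimum π σ =
  (λ where (_ , A , B , a , b , refl) → A , a , p∩q⊆p A B) ,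
  (λ where (_ , A , B , a , b , refl) → B , b , p∩q⊆q A B) ,
  λ ρ ρ≤π ρ≤σ r →
    let A , a , C⊆A = ρ≤π r
        B , b , C⊆B = ρ≤σ r
        x , x∈C     = nonempty ρ r
    in A ∩ B , ((x , x∈p∩q⁺ (C⊆A x∈C , C⊆B x∈C)) , A , B , a , b , refl) ,
       λ y∈C → x∈p∩q⁺ (C⊆A y∈C , C⊆B y∈C)

private
  ∈-resp : ∀ {A B : Subset n} {x} → A ≡ B → x ∈ A → x ∈ B
  ∈-resp refl x∈A = x∈A

  dec-true⁻ : ∀ {P : Set} (P? : Dec P) → does P? ≡ inside → P
  dec-true⁻ (yes p) _  = p
  dec-true⁻ (no _)  ()

-- S is a union of blocks of π.
Saturated : Partition n → Pred (Subset n) 0ℓ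
Saturated π S = ∀ {A x} → Block π A → x ∈ A → x ∈ S → A ⊆ S

private
  saturated? : (π : Partition n) → Decidable (Saturated π)
  saturated? π S = map′ to from (all? λ x → (x ∈? S) →-dec (block π x ⊆? S))
    where
    to : (∀ x → x ∈ S → block π x ⊆ S) → Saturated π S
    to h {A} {x} a x∈A x∈S y∈A =
      h x x∈S (∈-resp (disjoint π a (block-isBlock π x) x∈A (x∈block π x)) y∈A)

    from : Saturated π S → ∀ x → x ∈ S → block π x ⊆ S
    from s x x∈S = s (block-isBlock π x) (x∈block π x) x∈S

  saturated-∩ : (π : Partition n) {S T : Subset n} →
                Saturated π S → Saturated π T → Saturated π (S ∩ T)
  saturated-∩ π {S} {T} s t a x∈A x∈S∩T y∈A =
    let x∈S , x∈T = x∈p∩q⁻ S T x∈S∩T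
    in x∈p∩q⁺ (s a x∈A x∈S y∈A , t a x∈A x∈T y∈A)

  saturated-∁ : (π : Partition n) {S : Subset n} → Saturated π S → Saturated π (∁ S)
  saturated-∁ π s a x∈A x∈∁S y∈A =
    x∉p⇒x∈∁p λ y∈S → x∈∁p⇒x∉p x∈∁S (s a y∈A y∈S x∈A)

module _ (π σ : Partition n) where

  private
    Sat : Pred (Subset n) 0ℓ
    Sat S = Saturated π S × Saturated σ S

    Sat-∩ : ∀ {S T} → Sat S → Sat T → Sat (S ∩ T)
    Sat-∩ (s , s′) (t , t′) = saturated-∩ π s t , saturated-∩ σ s′ t′

  -- The blocks of the join are the minimal nonempty sets that are both a
  -- union of blocks of π and a union of blocks of σ.
  JoinBlock : Pred (Subset n) 0ℓ
  JoinBlock A = Nonempty A × Sat A ×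
                (∀ {S} → Nonempty S → Sat S → S ⊆ A → S ≡ A)

  private
    Separates : Fin n → Fin n → Pred (Subset n) 0ℓ
    Separates x y S = Sat S × x ∈ S × y ∉ S

    inseparable? : ∀ x y → Dec (¬ ∃ (Separates x y))
    inseparable? x y = ¬? (anySubset? λ S →
      (saturated? π S ×-dec saturated? σ S) ×-dec ((x ∈? S) ×-dec ¬? (y ∈? S)))

    hull : Fin n → Subset n
    hull x = tabulate λ y → does (inseparable? x y)

    ∈hull⁺ : ∀ {x y} → (∀ {S} → Sat S → x ∈ S → y ∈ S) → y ∈ hull x
    ∈hull⁺ {x} {y} h = lookup⇒[]= y (hull x)
      (trans (lookup∘tabulate _ y)
             (dec-true (inseparable? x y) λ (S , s , x∈S , y∉S) → y∉S (h s x∈S)))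

    ∈hull⁻ : ∀ {x y S} → y ∈ hull x → Sat S → x ∈ S → y ∈ S
    ∈hull⁻ {x} {y} {S} y∈ s x∈S =
      decidable-stable (y ∈? S) λ y∉S →
        dec-true⁻ (inseparable? x y)
                  (trans (sym (lookup∘tabulate _ y)) ([]=⇒lookup y∈))
                  (S , s , x∈S , y∉S)

    x∈hull : ∀ x → x ∈ hull x
    x∈hull x = ∈hull⁺ λ _ x∈S → x∈S

    hull-sat : ∀ x → Sat (hull x)
    hull-sat x =
      (λ a y∈A y∈ z∈A → ∈hull⁺ λ s x∈S → proj₁ s a y∈A (∈hull⁻ y∈ s x∈S) z∈A) ,
      (λ a y∈A y∈ z∈A → ∈hull⁺ λ s x∈S → proj₂ s a y∈A (∈hull⁻ y∈ s x∈S) z∈A)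

    hull-minimal : ∀ x {S} → Nonempty S → Sat S → S ⊆ hull x → S ≡ hull x
    hull-minimal x {S} (y , y∈S) s S⊆ with x ∈? S
    ... | yes x∈S = ⊆-antisym S⊆ λ z∈ → ∈hull⁻ z∈ s x∈S
    ... | no  x∉S = contradiction
      (∈hull⁻ (S⊆ y∈S) (saturated-∁ π (proj₁ s) , saturated-∁ σ (proj₂ s)) (x∉p⇒x∈∁p x∉S))
      (x∈p⇒x∉∁p y∈S)

    hull-joinBlock : ∀ x → JoinBlock (hull x)
    hull-joinBlock x = (x , x∈hull x) , hull-sat x , hull-minimal x

  infixr 6 _∨ₚ_

  _∨ₚ_ : Partition n
  _∨ₚ_ = record
    { Block    = JoinBlock
    ; nonempty = proj₁
    ; disjoint = λ {A} {B} {x} (_ , s , minA) (_ , t , minB) x∈A x∈B →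
        let ne = x , x∈p∩q⁺ (x∈A , x∈B)
        in trans (sym (minA ne (Sat-∩ s t) (p∩q⊆p A B))) (minB ne (Sat-∩ s t) (p∩q⊆q A B))
    ; covers   = λ x → hull x , hull-joinBlock x , x∈hull x
    }

  private
    ≤ₚ⇒saturated : ∀ (τ ρ : Partition n) {R} → τ ≤ₚ ρ → Block ρ R → Saturated τ R
    ≤ₚ⇒saturated τ ρ τ≤ρ r a x∈A x∈R y∈A =
      let R′ , r′ , A⊆R′ = τ≤ρ a
      in ∈-resp (disjoint ρ r′ r (A⊆R′ x∈A) x∈R) (A⊆R′ y∈A)

    ∨ₚ-least : ∀ ρ → π ≤ₚ ρ → σ ≤ₚ ρ → _∨ₚ_ ≤ₚ ρ
    ∨ₚ-least ρ π≤ρ σ≤ρ {A} ((x , x∈A) , s , min) = R , r , λ y∈A → p∩q⊆q A R (∈-resp (sym A∩R≡A) y∈A)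
      where
      R     = block ρ x
      r     = block-isBlock ρ x
      A∩R≡A = min (x , x∈p∩q⁺ (x∈A , x∈block ρ x))
                  (Sat-∩ s (≤ₚ⇒saturated π ρ π≤ρ r , ≤ₚ⇒saturated σ ρ σ≤ρ r))
                  (p∩q⊆p A R)

  ∨ₚ-supremum : π ≤ₚ _∨ₚ_ × σ ≤ₚ _∨ₚ_ × (∀ ρ → π ≤ₚ ρ → σ ≤ₚ ρ → _∨ₚ_ ≤ₚ ρ)
  ∨ₚ-supremum =
    (λ a → let x , x∈A = nonempty π a in
      hull x , hull-joinBlock x , proj₁ (hull-sat x) a x∈A (x∈hull x)) ,
    (λ a → let x , x∈A = nonempty σ a in
      hull x , hull-joinBlock x , proj₂ (hull-sat x) a x∈A (x∈hull x)) ,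
    ∨ₚ-least

Part : ℕ → Lattice (suc 0ℓ) 0ℓ 0ℓ
Part n = record
  { Carrier   = Partition n
  ; _≈_       = _≈ₚ_
  ; _≤_       = _≤ₚ_
  ; _∨_       = _∨ₚ_
  ; _∧_       = _∧ₚ_
  ; isLattice = record
    { isPartialOrder = ≤ₚ-isPartialOrder
    ; supremum       = ∨ₚ-supremum
    ; infimum        = ∧ₚ-infimum
    }
  }

------------------------------------------------------------------------
-- Boolean sublattices of largest size

module _ {c ℓ₁ ℓ₂ : Level} (L : Lattice c ℓ₁ ℓ₂) where

  open Lattice L using (Carrier; _≈_; _∨_; _∧_)

  record IsSublattice {ℓ : Level} (B : Pred Carrier ℓ) : Set (c ⊔ ℓ₁ ⊔ ℓ) where
    field
      respects : B Respects _≈_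
      ∨-closed : ∀ {x y} → B x → B y → B (x ∨ y)
      ∧-closed : ∀ {x y} → B x → B y → B (x ∧ y)

    join meet : Op₂ (∃ B)
    join (x , x∈B) (y , y∈B) = x ∨ y , ∨-closed x∈B y∈B
    meet (x , x∈B) (y , y∈B) = x ∧ y , ∧-closed x∈B y∈B

  -- The bounds of B need not be those of L.
  record IsBooleanSublattice {ℓ : Level} (B : Pred Carrier ℓ) : Set (c ⊔ ℓ₁ ⊔ ℓ) where
    field
      isSublattice : IsSublattice B

    open IsSublattice isSublattice public

    field
      complement       : Op₁ (∃ B)
      top bottom       : ∃ B
      isBooleanAlgebra : IsBooleanAlgebra (_≈_ on proj₁) join meet complement top bottom

  subsetoid : {ℓ : Level} → Pred Carrier ℓ → Setoid (c ⊔ ℓ) ℓ₁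
  subsetoid B = On.setoid {B = ∃ B} (Lattice.setoid L) proj₁

  HasSize : {ℓ : Level} → Pred Carrier ℓ → ℕ → Set (c ⊔ ℓ₁ ⊔ ℓ)
  HasSize B m = Inverse (subsetoid B) (setoid (Fin m))

  record IsLargestBooleanSublattice {ℓ : Level} (B : Pred Carrier ℓ) : Set (c ⊔ ℓ₁ ⊔ suc ℓ) where
    field
      isBooleanSublattice : IsBooleanSublattice B
      size                : ℕ
      hasSize             : HasSize B size
      largest             : ∀ (B′ : Pred Carrier ℓ) {m} →
                            IsBooleanSublattice B′ → HasSize B′ m → m ≤ size

------------------------------------------------------------------------
-- Semi-interval systems

record IsClosureSystem {n : ℕ} (Q : Pred (Subset n) 0ℓ) : Set where
  field
    V∈Q      : Q ⊤
    -- ℘(V) is finite, so every subfamily of Q is listed by some list.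
    ⋂-closed : ∀ {F : List (Subset n)} → All Q F → Q (⋂ F)

record IsSemiIntervalSystem {n : ℕ} (I : Pred (Subset n) 0ℓ) : Set where
  field
    isClosureSystem : IsClosureSystem I
    ∅∈I             : I ⊥
    ⁅x⁆∈I           : ∀ x → I ⁅ x ⁆
    ∪-closed        : ∀ {A B} → I A → I B → Nonempty (A ∩ B) → I (A ∪ B)

𝓓 : Pred (Subset n) 0ℓ → Pred (Partition n) 0ℓ
𝓓 I π = ∀ {A} → Block π A → I A

{-# OPTIONS --safe #-}
module Submission where

-- Let the rank of a partition be the number of elements that are not least in their block; it is
-- strictly monotone and at most n − 1.  Splitting a Boolean algebra at an element c by
-- u ↦ (u ∧ c , u ∨ c) bounds its size by 2 ^ (rank of top − rank of bottom), and the partitions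
-- whose nontrivial block, if any, is unique and contains a fixed point form a Boolean sublattice
-- of size 2 ^ (n − 1).  So a largest B contains both bounds of Part(V), and every element of B of
-- rank at least 2 is a join of two smaller ones.  By induction on the rank, B therefore contains
-- with π every restriction of π to a union S of blocks of π, all points outside S being made
-- singletons.  With this, B is recovered from the set of all blocks of its elements.

open import Level using (0ℓ; _⊔_)
open import Algebra.Lattice.Bundles using (BooleanAlgebra)
import Algebra.Lattice.Morphism.LatticeMonomorphism as LatticeMonomorphism
open import Algebra.Lattice.Morphism.Structures using (IsLatticeMonomorphism)
import Algebra.Lattice.Properties.BooleanAlgebra as BooleanAlgebraProperties
import Algebra.Lattice.Properties.Lattice as LatticeProperties
open import Data.Bool.Base using (Bool; true)
open import Data.Fin.Base as Fin using (Fin; zero; suc; combine; funToFin; finToFun)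
import Data.Fin.Induction as Fin
open import Data.Fin.Properties as Fin
  using (_≟_; 2↔Bool; any?; injective⇒≤; funToFin-finToFin; finToFun-funToFin)
open import Data.Fin.Subset
  using (Subset; inside; _∈_; _⊆_; _∩_; _∪_; ∁; ⊤; ⊥; ⁅_⁆; ∣_∣; Nonempty; ⋂)
open import Data.Fin.Subset.Properties
open import Data.List.Base using ([]; _∷_; allFin)
open import Data.List.Membership.Propositional using () renaming (_∈_ to _∈ₗ_)
open import Data.List.Membership.Propositional.Properties using (∈-allFin)
open import Data.List.Relation.Unary.All using (All; []; _∷_)
open import Data.List.Relation.Unary.Any using (here; there)
open import Data.Nat.Base using (ℕ; zero; suc; _+_; _∸_; _^_; _≤_; _<_; z≤n; s≤s)
open import Data.Nat.Induction using (<-wellFounded)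
import Data.Nat.Properties as ℕ
open import Data.Product using (∃; _×_; _,_; proj₁; proj₂)
open import Data.Sum.Base using (_⊎_; inj₁; inj₂; [_,_]′)
open import Data.Unit.Base using (tt) renaming (⊤ to Unit)
open import Data.Vec.Base using (Vec; []; _∷_; _++_; here; there; lookup; replicate; tabulate; tail; zipWith)
open import Data.Vec.Properties
  using (lookup∘tabulate; tabulate∘lookup; tabulate-cong; ++-injective; ∷-injectiveˡ; []=⇒lookup; lookup⇒[]=)
open import Function.Base using (_∘_; id)
open import Function.Bundles using (Inverse)
open import Function.Definitions using (Injective; Congruent)
open import Induction.WellFounded using (Acc; acc)
open import Relation.Binary.Bundles using (Poset)
open import Relation.Binary.Core using (Rel)
open import Relation.Binary.Definitions using (tri<; tri≈; tri>)
import Relation.Binary.Lattice as Order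
open import Relation.Binary.PropositionalEquality
  using (_≡_; refl; sym; trans; cong; cong₂; subst; isDecEquivalence; module ≡-Reasoning)
import Relation.Binary.Reasoning.Setoid as ≈-Reasoning
open import Relation.Binary.Structures using (IsDecEquivalence)
open import Relation.Nullary using (¬_; Dec; yes; no; does; contradiction)
open import Relation.Nullary.Decidable using (map′; _×-dec_; _⊎-dec_; ¬?; decidable-stable; dec-true)
open import Relation.Unary using (Pred; Decidable; _≐_)
open import Relation.Unary.Properties using (≐-sym; ≐-trans)
open import Defs

open Partition

-- Numbering of bit vectors.

-- Pointwise equal functions need not be propositionally equal, so that `funToFin` depends only on
-- the values takes an induction.
funToFin-cong : ∀ {m k} {f g : Fin k → Fin m} → (∀ i → f i ≡ g i) → funToFin f ≡ funToFin g
funToFin-cong {k = zero}  f≗g = refl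
funToFin-cong {k = suc k} f≗g = cong₂ combine (f≗g zero) (funToFin-cong (f≗g ∘ suc))

module _ {k : ℕ} where

  encode : Vec Bool k → Fin (2 ^ k)
  encode v = funToFin (Inverse.from 2↔Bool ∘ lookup v)

  decode : Fin (2 ^ k) → Vec Bool k
  decode i = tabulate (Inverse.to 2↔Bool ∘ finToFun i)

  decode∘encode : ∀ v → decode (encode v) ≡ v
  decode∘encode v = trans (tabulate-cong bit) (tabulate∘lookup v)
    where
    bit : ∀ j → Inverse.to 2↔Bool (finToFun (encode v) j) ≡ lookup v j
    bit j = trans (cong (Inverse.to 2↔Bool) (finToFun-funToFin _ j))
      (Inverse.strictlyInverseˡ 2↔Bool (lookup v j))

  encode∘decode : ∀ i → encode (decode i) ≡ i
  encode∘decode i = trans (funToFin-cong bit) (funToFin-finToFin {k} {2} i)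
    where
    bit : ∀ j → Inverse.from 2↔Bool (lookup (decode i) j) ≡ finToFun i j
    bit j = trans (cong (Inverse.from 2↔Bool) (lookup∘tabulate _ j))
      (Inverse.strictlyInverseʳ 2↔Bool (finToFun i j))

-- Size bound for ranked Boolean algebras.

-- `index` and `enum` number the classes of `≈`, which makes equality and bounded search decidable.
-- `rank-strict` is strict monotonicity in contrapositive form.
record Ranking {a ℓ} (𝔸 : BooleanAlgebra a ℓ) (m : ℕ) : Set (a ⊔ ℓ) where
  open BooleanAlgebra 𝔸 using (Carrier; _≈_; lattice)
  open Poset (LatticeProperties.poset lattice) using () renaming (_≤_ to _⊑_)
  field
    index           : Carrier → Fin m
    enum            : Fin m → Carrier
    index-cong      : Congruent _≈_ _≡_ index
    index-injective : Injective _≈_ _≡_ index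
    index∘enum      : ∀ i → index (enum i) ≡ i
    rank            : Carrier → ℕ
    rank-mono       : ∀ {x y} → x ⊑ y → rank x ≤ rank y
    rank-strict     : ∀ {x y} → x ⊑ y → rank y ≤ rank x → x ≈ y

module RankedBooleanAlgebra {a ℓ} {𝔸 : BooleanAlgebra a ℓ} {m : ℕ} (ranking : Ranking 𝔸 m) where

  open BooleanAlgebra 𝔸
    renaming (sym to ≈-sym; trans to ≈-trans; ¬_ to _ᶜ; ⊤ to 𝟙; ⊥ to 𝟘) hiding (refl)
  open Ranking ranking
  open Order.Lattice (LatticeProperties.∨-∧-orderTheoreticLattice lattice)
    using (y≤x∨y; ∨-least; x∧y≤x; x∧y≤y; ∧-greatest)
    renaming ( _≤_ to _⊑_; refl to ⊑-refl; trans to ⊑-trans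
             ; reflexive to ⊑-reflexive; antisym to ⊑-antisym )
  open BooleanAlgebraProperties 𝔸 using (∧-identityʳ; ∧-zeroˡ)

  infix 4 _⊏_
  _⊏_ : Carrier → Carrier → Set ℓ
  x ⊏ y = x ⊑ y × ¬ (x ≈ y)

  _≈?_ : ∀ x y → Dec (x ≈ y)
  x ≈? y = map′ index-injective index-cong (index x ≟ index y)

  _⊏?_ : ∀ x y → Dec (x ⊏ y)
  x ⊏? y = (x ≈? (x ∧ y)) ×-dec ¬? (x ≈? y)

  ⊏-respʳ-≈ : ∀ {x y z} → y ≈ z → x ⊏ y → x ⊏ z
  ⊏-respʳ-≈ y≈z (x⊑y , x≉y) =
    ⊑-trans x⊑y (⊑-reflexive y≈z) , λ x≈z → x≉y (≈-trans x≈z (≈-sym y≈z))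

  ⊏-respˡ-≈ : ∀ {x y z} → y ≈ z → y ⊏ x → z ⊏ x
  ⊏-respˡ-≈ y≈z (y⊑x , y≉x) =
    ⊑-trans (⊑-reflexive (≈-sym y≈z)) y⊑x , λ z≈x → y≉x (≈-trans y≈z z≈x)

  rank-< : ∀ {x y} → x ⊏ y → rank x < rank y
  rank-< (x⊑y , x≉y) = ℕ.≰⇒> λ y≤x → x≉y (rank-strict x⊑y y≤x)

  between? : ∀ x y → Dec (∃ λ z → x ⊏ z × z ⊏ y)
  between? x y = map′ (λ (i , p) → enum i , p) to (any? λ i → (x ⊏? enum i) ×-dec (enum i ⊏? y))
    where
    to : (∃ λ z → x ⊏ z × z ⊏ y) → ∃ λ i → x ⊏ enum i × enum i ⊏ y
    to (z , x⊏z , z⊏y) = index z , ⊏-respʳ-≈ z≈ x⊏z , ⊏-respˡ-≈ z≈ z⊏y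
      where
      z≈ : z ≈ enum (index z)
      z≈ = index-injective (sym (index∘enum (index z)))

  -- By distributivity, absorption rebuilds `x` from `x ∨ z` and `x ∧ z`. This makes the splitting
  -- map `u ↦ (u ∧ z , u ∨ z)` injective.
  ∧-∨-cancelʳ : ∀ {x y z} → x ∧ z ≈ y ∧ z → x ∨ z ≈ y ∨ z → x ≈ y
  ∧-∨-cancelʳ {x} {y} {z} ∧≈ ∨≈ = begin
    x                  ≈⟨ ∧-absorbs-∨ x z ⟨
    x ∧ (x ∨ z)        ≈⟨ ∧-congˡ ∨≈ ⟩
    x ∧ (y ∨ z)        ≈⟨ ∧-distribˡ-∨ x y z ⟩
    (x ∧ y) ∨ (x ∧ z)  ≈⟨ ∨-cong (∧-comm x y) ∧≈ ⟩
    (y ∧ x) ∨ (y ∧ z)  ≈⟨ ∧-distribˡ-∨ y x z ⟨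
    y ∧ (x ∨ z)        ≈⟨ ∧-congˡ ∨≈ ⟩
    y ∧ (y ∨ z)        ≈⟨ ∧-absorbs-∨ y z ⟩
    y                  ∎
    where open ≈-Reasoning setoid

  -- An injection of the interval from `x` to `y` into the bit vectors of length `k`. The map is
  -- defined on the whole carrier, so that it takes no membership proofs.
  IntervalCode : Carrier → Carrier → ℕ → Set _
  IntervalCode x y k = ∃ λ (f : Carrier → Vec Bool k) →
    ∀ {u v} → x ⊑ u → u ⊑ y → x ⊑ v → v ⊑ y → f u ≡ f v → u ≈ v

  trivialCode : ∀ {x y} → x ≈ y → IntervalCode x y 0
  trivialCode {x} {y} x≈y = (λ _ → []) , λ x⊑u u⊑y x⊑v v⊑y _ →
    ≈-trans (≈-sym (collapse x⊑u u⊑y)) (collapse x⊑v v⊑y)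
    where
    collapse : ∀ {u} → x ⊑ u → u ⊑ y → x ≈ u
    collapse x⊑u u⊑y = ⊑-antisym x⊑u (⊑-trans u⊑y (⊑-reflexive (≈-sym x≈y)))

  -- With nothing strictly in between, the interval has only the elements `x` and `y`. One bit,
  -- testing for `x`, separates them; the other `k` bits are padding.
  coverCode : ∀ {x y} k → ¬ (∃ λ z → x ⊏ z × z ⊏ y) → IntervalCode x y (suc k)
  coverCode {x} {y} k gap = f , injective
    where
    f : Carrier → Vec Bool (suc k)
    f u = does (index u ≟ index x) ∷ replicate k true

    top : ∀ {u} → ¬ (u ≈ x) → x ⊑ u → u ⊑ y → u ≈ y
    top {u} u≉x x⊑u u⊑y with u ≈? y
    ... | yes u≈y = u≈y
    ... | no  u≉y = contradiction (u , (x⊑u , u≉x ∘ ≈-sym) , (u⊑y , u≉y)) gap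

    injective : ∀ {u v} → x ⊑ u → u ⊑ y → x ⊑ v → v ⊑ y → f u ≡ f v → u ≈ v
    injective {u} {v} x⊑u u⊑y x⊑v v⊑y eq
      with index u ≟ index x | index v ≟ index x | ∷-injectiveˡ eq
    ... | yes u≡x | yes v≡x | _ = index-injective (trans u≡x (sym v≡x))
    ... | no  u≢x | no  v≢x | _ =
      ≈-trans (top (u≢x ∘ index-cong) x⊑u u⊑y) (≈-sym (top (v≢x ∘ index-cong) x⊑v v⊑y))
    ... | yes _   | no  _   | ()
    ... | no  _   | yes _   | ()

  -- The interval [x , y] embeds into [x , z] × [z , y] by u ↦ (u ∧ z , u ∨ z).
  appendCode : ∀ {x y z j k} → x ⊑ z → z ⊑ y →
               IntervalCode x z j → IntervalCode z y k → IntervalCode x y (j + k)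
  appendCode {x} {y} {z} {j} {k} x⊑z z⊑y (f , f-inj) (g , g-inj) = h , injective
    where
    h : Carrier → Vec Bool (j + k)
    h u = f (u ∧ z) ++ g (u ∨ z)

    injective : ∀ {u v} → x ⊑ u → u ⊑ y → x ⊑ v → v ⊑ y → h u ≡ h v → u ≈ v
    injective {u} {v} x⊑u u⊑y x⊑v v⊑y eq
      with f≡ , g≡ ← ++-injective (f (u ∧ z)) (f (v ∧ z)) eq = ∧-∨-cancelʳ
      (f-inj (∧-greatest x⊑u x⊑z) (x∧y≤y u z) (∧-greatest x⊑v x⊑z) (x∧y≤y v z) f≡)
      (g-inj (y≤x∨y u z) (∨-least u⊑y z⊑y) (y≤x∨y v z) (∨-least v⊑y z⊑y) g≡)

  -- Strong induction on the bit budget. An element `z` strictly between splits the budget into `d`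
  -- and `suc k ∸ d`. Both are smaller than `suc k`, because the rank rises strictly from `x` to `z`
  -- and from `z` to `y`.
  intervalCode : ∀ {x y} k → Acc _<_ k → x ⊑ y → rank y ≤ rank x + k → IntervalCode x y k
  intervalCode {x} {y} zero _ x⊑y y≤x =
    trivialCode (rank-strict x⊑y (ℕ.≤-trans y≤x (ℕ.≤-reflexive (ℕ.+-identityʳ _))))
  intervalCode {x} {y} (suc k) (acc rs) x⊑y y≤x with between? x y
  ... | no gap = coverCode k gap
  ... | yes (z , x⊏z , z⊏y) = subst (IntervalCode x y) (ℕ.m+[n∸m]≡n (ℕ.<⇒≤ d<))
    (appendCode (proj₁ x⊏z) (proj₁ z⊏y)
      (intervalCode d (rs d<) (proj₁ x⊏z) (ℕ.≤-reflexive (sym x+d≡z)))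
      (intervalCode (suc k ∸ d) (rs (ℕ.∸-monoʳ-< d> (ℕ.<⇒≤ d<))) (proj₁ z⊏y) y≤z+))
    where
    d = rank z ∸ rank x

    x+d≡z : rank x + d ≡ rank z
    x+d≡z = ℕ.m+[n∸m]≡n (rank-mono (proj₁ x⊏z))

    d> : 0 < d
    d> = ℕ.m<n⇒0<n∸m (rank-< x⊏z)

    d< : d < suc k
    d< = ℕ.+-cancelˡ-< (rank x) d (suc k)
      (ℕ.≤-trans (s≤s (ℕ.≤-reflexive x+d≡z)) (ℕ.≤-trans (rank-< z⊏y) y≤x))

    y≤z+ : rank y ≤ rank z + (suc k ∸ d)
    y≤z+ = begin
      rank y                        ≤⟨ y≤x ⟩
      rank x + suc k                ≡⟨ cong (rank x +_) (ℕ.m+[n∸m]≡n (ℕ.<⇒≤ d<)) ⟨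
      rank x + (d + (suc k ∸ d))    ≡⟨ ℕ.+-assoc (rank x) d _ ⟨
      rank x + d + (suc k ∸ d)      ≡⟨ cong (_+ (suc k ∸ d)) x+d≡z ⟩
      rank z + (suc k ∸ d)          ∎
      where open ℕ.≤-Reasoning

  𝟘⊑ : ∀ x → 𝟘 ⊑ x
  𝟘⊑ x = ≈-sym (∧-zeroˡ x)

  ⊑𝟙 : ∀ x → x ⊑ 𝟙
  ⊑𝟙 x = ≈-sym (∧-identityʳ x)

  code⇒size≤ : ∀ {k} → IntervalCode 𝟘 𝟙 k → m ≤ 2 ^ k
  code⇒size≤ (f , f-inj) = injective⇒≤ {f = encode ∘ f ∘ enum} λ {i} {j} eq →
    trans (sym (index∘enum i)) (trans (index-cong (f-inj (𝟘⊑ _) (⊑𝟙 _) (𝟘⊑ _) (⊑𝟙 _)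
      (trans (sym (decode∘encode _)) (trans (cong decode eq) (decode∘encode _))))) (index∘enum j))

  code : ∀ {x y} → x ⊑ y → IntervalCode x y (rank y ∸ rank x)
  code {x} {y} x⊑y = intervalCode _ (<-wellFounded _) x⊑y (ℕ.m≤n+m∸n (rank y) (rank x))

  size≤2^rank : m ≤ 2 ^ (rank 𝟙 ∸ rank 𝟘)
  size≤2^rank = code⇒size≤ (code (𝟘⊑ 𝟙))

  -- If nothing lies strictly between `𝟘` and `x`, the part below `x` costs a single bit however
  -- large `rank x` is.
  between⊎size≤ : ∀ x → (∃ λ z → 𝟘 ⊏ z × z ⊏ x) ⊎ m ≤ 2 ^ suc (rank 𝟙 ∸ rank x)
  between⊎size≤ x with between? 𝟘 x
  ... | yes p  = inj₁ p
  ... | no gap = inj₂ (code⇒size≤ (appendCode (𝟘⊑ x) (⊑𝟙 x) (coverCode 0 gap) (code (⊑𝟙 x))))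

  -- The witness is the complement of `z` relative to `x`. Were it all of `x`, then `z` would lie
  -- below its own complement and be `𝟘`.
  split : ∀ {x z} → 𝟘 ⊏ z → z ⊏ x → ∃ λ z′ → z′ ⊏ x × z ∨ z′ ≈ x
  split {x} {z} (_ , 𝟘≉z) (z⊑x , _) = x ∧ z ᶜ , (x∧y≤x x (z ᶜ) , proper) , (begin
    z ∨ (x ∧ z ᶜ)        ≈⟨ ∨-distribˡ-∧ z x (z ᶜ) ⟩
    (z ∨ x) ∧ (z ∨ z ᶜ)  ≈⟨ ∧-cong (⊑-antisym (∨-least z⊑x ⊑-refl) (y≤x∨y z x)) (∨-complementʳ z) ⟩
    x ∧ 𝟙                ≈⟨ ∧-identityʳ x ⟩
    x                    ∎)
    where
    open ≈-Reasoning setoid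
    proper : ¬ (x ∧ z ᶜ ≈ x)
    proper eq = 𝟘≉z (⊑-antisym (𝟘⊑ z) (⊑-trans
      (∧-greatest ⊑-refl (⊑-trans (⊑-trans z⊑x (⊑-reflexive (≈-sym eq))) (x∧y≤y x (z ᶜ))))
      (⊑-reflexive (∧-complementʳ z))))

-- Partitions of a finite set as equivalence relations.

module _ {n : ℕ} {P : Pred (Fin n) 0ℓ} (P? : Decidable P) where

  comprehension : Subset n
  comprehension = tabulate (does ∘ P?)

  ∈-comprehension⁺ : ∀ {x} → P x → x ∈ comprehension
  ∈-comprehension⁺ {x} px = lookup⇒[]= x _ (trans (lookup∘tabulate _ x) (dec-true (P? x) px))

  ∈-comprehension⁻ : ∀ {x} → x ∈ comprehension → P x
  ∈-comprehension⁻ {x} x∈ with P? x | trans (sym (lookup∘tabulate (does ∘ P?) x)) ([]=⇒lookup x∈)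
  ... | yes px | _  = px
  ... | no  _  | ()

module _ {n : ℕ} where

  open Order.Lattice (Part n) public
    using ()
    renaming ( antisym to ≤ₚ-antisym; trans to ≤ₚ-trans; reflexive to ≤ₚ-reflexive
             ; x≤x∨y to π≤π∨σ; y≤x∨y to σ≤π∨σ; ∨-least to ∨ₚ-least; x∧y≤y to π∧σ≤σ )

  infix 4 _∋_~_
  _∋_~_ : Partition n → Fin n → Fin n → Set
  π ∋ x ~ y = y ∈ block π x

  module _ (π : Partition n) where

    block-unique : ∀ {A x} → Block π A → x ∈ A → A ≡ block π x
    block-unique {x = x} a x∈A = disjoint π a (block-isBlock π x) x∈A (x∈block π x)

    ~⇒block≡ : ∀ {x y} → π ∋ x ~ y → block π x ≡ block π y
    ~⇒block≡ {x} = block-unique (block-isBlock π x)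

    ~-refl : ∀ {x} → π ∋ x ~ x
    ~-refl = x∈block π _

    ~-sym : ∀ {x y} → π ∋ x ~ y → π ∋ y ~ x
    ~-sym x~y = subst (_ ∈_) (~⇒block≡ x~y) ~-refl

    ~-trans : ∀ {x y z} → π ∋ x ~ y → π ∋ y ~ z → π ∋ x ~ z
    ~-trans x~y y~z = subst (_ ∈_) (sym (~⇒block≡ x~y)) y~z

    saturated⁺ : ∀ {S} → (∀ {x y} → π ∋ x ~ y → x ∈ S → y ∈ S) → Saturated π S
    saturated⁺ closed a x∈A x∈S y∈A = closed (subst (_ ∈_) (block-unique a x∈A) y∈A) x∈S

    saturated⁻ : ∀ {S x y} → Saturated π S → π ∋ x ~ y → x ∈ S → y ∈ S
    saturated⁻ {x = x} s x~y x∈S = s (block-isBlock π x) ~-refl x∈S x~y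

    block-saturated : ∀ x → Saturated π (block π x)
    block-saturated x = saturated⁺ λ y~z x~y → ~-trans x~y y~z

    ∩-saturated : ∀ {S T} → Saturated π S → Saturated π T → Saturated π (S ∩ T)
    ∩-saturated {S} {T} s t = saturated⁺ λ x~y x∈S∩T →
      let x∈S , x∈T = x∈p∩q⁻ S T x∈S∩T in x∈p∩q⁺ (saturated⁻ s x~y x∈S , saturated⁻ t x~y x∈T)

  ≤ₚ⇒~ : ∀ π σ {x y} → π ≤ₚ σ → π ∋ x ~ y → σ ∋ x ~ y
  ≤ₚ⇒~ π σ {x} π≤σ x~y with B , b , ⊆B ← π≤σ (block-isBlock π x) =
    subst (_ ∈_) (block-unique σ b (⊆B (~-refl π))) (⊆B x~y)

  ~⇒≤ₚ : ∀ π σ → (∀ {x y} → π ∋ x ~ y → σ ∋ x ~ y) → π ≤ₚ σ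
  ~⇒≤ₚ π σ ~⇒~ a with x , x∈A ← nonempty π a =
    block σ x , block-isBlock σ x , λ y∈A → ~⇒~ (subst (_ ∈_) (block-unique π a x∈A) y∈A)

  saturated-anti : ∀ π σ {S} → π ≤ₚ σ → Saturated σ S → Saturated π S
  saturated-anti π σ π≤σ s = saturated⁺ π λ x~y → saturated⁻ σ s (≤ₚ⇒~ π σ π≤σ x~y)

  -- A block of the join is minimal among the nonempty sets saturated for both partitions, so a
  -- block `A` that meets `S` equals `A ∩ S`. This replaces chains of alternating equivalences: a
  -- block of a join is bounded by exhibiting a set saturated for both.
  ∨ₚ-saturated : ∀ π σ {S} → Saturated π S → Saturated σ S → Saturated (π ∨ₚ σ) S
  ∨ₚ-saturated π σ {S} s t {A} {x} (_ , (sA , tA) , minimal) x∈A x∈S y∈A =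
    p∩q⊆q A S (subst (_ ∈_) (sym A∩S≡A) y∈A)
    where
    A∩S≡A : A ∩ S ≡ A
    A∩S≡A = minimal (x , x∈p∩q⁺ (x∈A , x∈S)) (∩-saturated π sA s , ∩-saturated σ tA t) (p∩q⊆p A S)

  module _ {R : Rel (Fin n) 0ℓ} (isDecEq : IsDecEquivalence R) where

    private
      module R = IsDecEquivalence isDecEq

    -- Blocks are Boolean vectors, so decidability of the relation is what lets its classes be
    -- formed.
    fromDecEquivalence : Partition n
    fromDecEquivalence = record
      { Block    = λ A → ∃ λ x → A ≡ class x
      ; nonempty = λ where (x , refl) → x , x∈class
      ; disjoint = λ where
          (x , refl) (y , refl) z∈x z∈y → let
            xRz = ∈-comprehension⁻ (x R.≟_) z∈x
            yRz = ∈-comprehension⁻ (y R.≟_) z∈y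
            in ⊆-antisym (class-⊆ (R.trans yRz (R.sym xRz))) (class-⊆ (R.trans xRz (R.sym yRz)))
      ; covers   = λ x → class x , (x , refl) , x∈class
      }
      where
      class : Fin n → Subset n
      class x = comprehension (x R.≟_)

      x∈class : ∀ {x} → x ∈ class x
      x∈class {x} = ∈-comprehension⁺ (x R.≟_) R.refl

      class-⊆ : ∀ {x y} → R y x → class x ⊆ class y
      class-⊆ {x} {y} yRx z∈x = ∈-comprehension⁺ (y R.≟_) (R.trans yRx (∈-comprehension⁻ (x R.≟_) z∈x))

    fromDecEquivalence⁺ : ∀ {x y} → R x y → fromDecEquivalence ∋ x ~ y
    fromDecEquivalence⁺ {x} = ∈-comprehension⁺ (x R.≟_)

    fromDecEquivalence⁻ : ∀ {x y} → fromDecEquivalence ∋ x ~ y → R x y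
    fromDecEquivalence⁻ {x} = ∈-comprehension⁻ (x R.≟_)

  discrete : Partition n
  discrete = fromDecEquivalence (isDecEquivalence _≟_)

  discrete⁻ : ∀ {x y} → discrete ∋ x ~ y → x ≡ y
  discrete⁻ = fromDecEquivalence⁻ (isDecEquivalence _≟_)

  discrete≤ : ∀ π → discrete ≤ₚ π
  discrete≤ π = ~⇒≤ₚ discrete π λ x~y → subst (π ∋ _ ~_) (discrete⁻ x~y) (~-refl π)

  private
    total : IsDecEquivalence {A = Fin n} (λ _ _ → Unit)
    total = record
      { isEquivalence = record { refl = tt ; sym = λ _ → tt ; trans = λ _ _ → tt }
      ; _≟_           = λ _ _ → yes tt
      }

  indiscrete : Partition n
  indiscrete = fromDecEquivalence total

  indiscrete-~ : ∀ {x y} → indiscrete ∋ x ~ y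
  indiscrete-~ {x} = fromDecEquivalence⁺ total {x} tt

  ≤indiscrete : ∀ π → π ≤ₚ indiscrete
  ≤indiscrete π = ~⇒≤ₚ π indiscrete λ {x} _ → indiscrete-~ {x}

  -- Restricting and merging partitions.

  module _ (π : Partition n) (S : Subset n) where

    private
      RestrictRel : Rel (Fin n) 0ℓ
      RestrictRel x y = x ≡ y ⊎ (x ∈ S × y ∈ S × π ∋ x ~ y)

      restrictRel-isDecEquivalence : IsDecEquivalence RestrictRel
      restrictRel-isDecEquivalence = record
        { isEquivalence = record
          { refl  = inj₁ refl
          ; sym   = λ where
              (inj₁ refl)              → inj₁ refl
              (inj₂ (x∈S , y∈S , x~y)) → inj₂ (y∈S , x∈S , ~-sym π x~y)
          ; trans = λ where
              (inj₁ refl) yRz → yRz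
              xRy@(inj₂ _) (inj₁ refl) → xRy
              (inj₂ (x∈S , _ , x~y)) (inj₂ (_ , z∈S , y~z)) → inj₂ (x∈S , z∈S , ~-trans π x~y y~z)
          }
        ; _≟_ = λ x y → (x ≟ y) ⊎-dec ((x ∈? S) ×-dec ((y ∈? S) ×-dec (y ∈? block π x)))
        }

    restrict : Partition n
    restrict = fromDecEquivalence restrictRel-isDecEquivalence

    restrict⁺ : ∀ {x y} → x ∈ S → y ∈ S → π ∋ x ~ y → restrict ∋ x ~ y
    restrict⁺ x∈S y∈S x~y = fromDecEquivalence⁺ restrictRel-isDecEquivalence (inj₂ (x∈S , y∈S , x~y))

    restrict⁻ : ∀ {x y} → restrict ∋ x ~ y → x ≡ y ⊎ (x ∈ S × y ∈ S × π ∋ x ~ y)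
    restrict⁻ = fromDecEquivalence⁻ restrictRel-isDecEquivalence

    restrict≤ : restrict ≤ₚ π
    restrict≤ = ~⇒≤ₚ restrict π λ x~y → go (restrict⁻ x~y)
      where
      go : ∀ {x y} → RestrictRel x y → π ∋ x ~ y
      go (inj₁ refl)          = ~-refl π
      go (inj₂ (_ , _ , x~y)) = x~y

  -- The partition whose only possibly nontrivial block is A.
  merge : Subset n → Partition n
  merge = restrict indiscrete

  merge⁺ : ∀ {A x y} → x ∈ A → y ∈ A → merge A ∋ x ~ y
  merge⁺ {A} {x} x∈A y∈A = restrict⁺ indiscrete A x∈A y∈A (indiscrete-~ {x})

  merge⁻ : ∀ {A x y} → merge A ∋ x ~ y → x ≡ y ⊎ (x ∈ A × y ∈ A)
  merge⁻ {A} x~y with restrict⁻ indiscrete A x~y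
  ... | inj₁ x≡y             = inj₁ x≡y
  ... | inj₂ (x∈A , y∈A , _) = inj₂ (x∈A , y∈A)

  merge-saturated : ∀ {A S} → A ⊆ S → Saturated (merge A) S
  merge-saturated {A} {S} A⊆S = saturated⁺ (merge A) λ x~y x∈S → go x∈S (merge⁻ x~y)
    where
    go : ∀ {x y} → x ∈ S → x ≡ y ⊎ (x ∈ A × y ∈ A) → y ∈ S
    go x∈S (inj₁ refl)      = x∈S
    go _   (inj₂ (_ , y∈A)) = A⊆S y∈A

  merge-block≤ : ∀ π {A} → Block π A → merge A ≤ₚ π
  merge-block≤ π {A} a = ~⇒≤ₚ (merge A) π λ x~y → go (merge⁻ x~y)
    where
    go : ∀ {x y} → x ≡ y ⊎ (x ∈ A × y ∈ A) → π ∋ x ~ y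
    go (inj₁ refl)        = ~-refl π
    go (inj₂ (x∈A , y∈A)) = subst (_ ∈_) (block-unique π a x∈A) y∈A

  restrict-mono : ∀ π σ S → π ≤ₚ σ → restrict π S ≤ₚ restrict σ S
  restrict-mono π σ S π≤σ = ~⇒≤ₚ (restrict π S) (restrict σ S) λ {x} x~y → go {x} (restrict⁻ π S x~y)
    where
    go : ∀ {x y} → x ≡ y ⊎ (x ∈ S × y ∈ S × π ∋ x ~ y) → restrict σ S ∋ x ~ y
    go (inj₁ refl)              = ~-refl (restrict σ S)
    go (inj₂ (x∈S , y∈S , x~y)) = restrict⁺ σ S x∈S y∈S (≤ₚ⇒~ π σ π≤σ x~y)

  restrict-cong : ∀ π σ S → π ≈ₚ σ → restrict π S ≈ₚ restrict σ S
  restrict-cong π σ S π≈σ = ≤ₚ-antisym {i = restrict π S} {restrict σ S}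
    (restrict-mono π σ S (≤ₚ-reflexive {x = π} {σ} π≈σ))
    (restrict-mono σ π S (≤ₚ-reflexive {x = σ} {π} (≐-sym π≈σ)))

  restrict-block : ∀ π {A} → Block π A → restrict π A ≈ₚ merge A
  restrict-block π {A} a = ≤ₚ-antisym {i = restrict π A} {merge A}
    (restrict-mono π indiscrete A (≤indiscrete π))
    (~⇒≤ₚ (merge A) (restrict π A) λ {x} x~y → go {x} (merge⁻ x~y))
    where
    go : ∀ {x y} → x ≡ y ⊎ (x ∈ A × y ∈ A) → restrict π A ∋ x ~ y
    go (inj₁ refl)        = ~-refl (restrict π A)
    go (inj₂ (x∈A , y∈A)) =
      restrict⁺ π A x∈A y∈A (≤ₚ⇒~ (merge A) π (merge-block≤ π a) (merge⁺ x∈A y∈A))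

  -- One direction is monotonicity. For the other, an equivalence of `π` or `σ` that starts in `S`
  -- stays in `S` and so belongs to the restriction. Hence the part in `S` of a block of `J` is
  -- saturated for both, and therefore for `π ∨ₚ σ`.
  restrict-∨ : ∀ π σ {S} → Saturated π S → Saturated σ S →
               restrict π S ∨ₚ restrict σ S ≈ₚ restrict (π ∨ₚ σ) S
  restrict-∨ π σ {S} s t = ≤ₚ-antisym {i = J} {K}
    (∨ₚ-least {restrict π S} {restrict σ S} {K}
      (restrict-mono π (π ∨ₚ σ) S (π≤π∨σ π σ)) (restrict-mono σ (π ∨ₚ σ) S (σ≤π∨σ π σ)))
    (~⇒≤ₚ K J λ {x} x~y → go {x} (restrict⁻ (π ∨ₚ σ) S x~y))
    where
    J = restrict π S ∨ₚ restrict σ S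
    K = restrict (π ∨ₚ σ) S

    saturated : ∀ {ρ} x → Saturated ρ S → restrict ρ S ≤ₚ J → Saturated ρ (block J x ∩ S)
    saturated {ρ} x r ρ≤J = saturated⁺ ρ λ u~v u∈ → let
      x~u , u∈S = x∈p∩q⁻ (block J x) S u∈
      v∈S = saturated⁻ ρ r u~v u∈S
      in x∈p∩q⁺ (~-trans J x~u (≤ₚ⇒~ (restrict ρ S) J ρ≤J (restrict⁺ ρ S u∈S v∈S u~v)) , v∈S)

    go : ∀ {x y} → x ≡ y ⊎ (x ∈ S × y ∈ S × π ∨ₚ σ ∋ x ~ y) → J ∋ x ~ y
    go (inj₁ refl) = ~-refl J
    go {x} (inj₂ (x∈S , y∈S , x~y)) = p∩q⊆p (block J x) S (saturated⁻ (π ∨ₚ σ)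
      (∨ₚ-saturated π σ
        (saturated {π} x s (π≤π∨σ (restrict π S) (restrict σ S)))
        (saturated {σ} x t (σ≤π∨σ (restrict π S) (restrict σ S))))
      x~y (x∈p∩q⁺ (~-refl J , x∈S)))

-- The rank of a partition.

module _ {k : ℕ} where

  NonLeast : Partition (suc k) → Pred (Fin (suc k)) 0ℓ
  NonLeast π x = ∃ λ y → y Fin.< x × π ∋ x ~ y

  nonLeast? : ∀ π → Decidable (NonLeast π)
  nonLeast? π x = any? λ y → (y Fin.<? x) ×-dec (y ∈? block π x)

  least : ∀ π x → ∃ λ y → ¬ NonLeast π y × π ∋ x ~ y
  least π x = go x (Fin.<-wellFounded x)
    where
    go : ∀ x → Acc Fin._<_ x → ∃ λ y → ¬ NonLeast π y × π ∋ x ~ y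
    go x (acc rs) with nonLeast? π x
    ... | no  x-least = x , x-least , ~-refl π
    ... | yes (y , y<x , x~y)
      with z , z-least , y~z ← go y (rs y<x) = z , z-least , ~-trans π x~y y~z

  least-unique : ∀ π {x y} → ¬ NonLeast π x → ¬ NonLeast π y → π ∋ x ~ y → x ≡ y
  least-unique π {x} {y} x-least y-least x~y with Fin.<-cmp x y
  ... | tri< x<y _ _ = contradiction (x , x<y , ~-sym π x~y) y-least
  ... | tri≈ _ x≡y _ = x≡y
  ... | tri> _ _ y<x = contradiction (y , y<x , x~y) x-least

  -- The element zero is always least, so it is left out.
  nonLeasts : Partition (suc k) → Subset k
  nonLeasts π = comprehension (nonLeast? π ∘ suc)

  rank : Partition (suc k) → ℕ
  rank π = ∣ nonLeasts π ∣

  rank≤ : ∀ π → rank π ≤ k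
  rank≤ π = ∣p∣≤n (nonLeasts π)

  nonLeasts-mono : ∀ π σ → π ≤ₚ σ → nonLeasts π ⊆ nonLeasts σ
  nonLeasts-mono π σ π≤σ x∈ with y , y<x , x~y ← ∈-comprehension⁻ (nonLeast? π ∘ suc) x∈ =
    ∈-comprehension⁺ (nonLeast? σ ∘ suc) (y , y<x , ≤ₚ⇒~ π σ π≤σ x~y)

  rank-mono : ∀ π σ → π ≤ₚ σ → rank π ≤ rank σ
  rank-mono π σ π≤σ = p⊆q⇒∣p∣≤∣q∣ (nonLeasts-mono π σ π≤σ)

  -- Inclusion with no growth in size means that both partitions have the same least elements. The
  -- `π`-least representatives of two `σ`-equivalent points are then least in the same `σ`-block,
  -- hence equal.
  rank-strict : ∀ π σ → π ≤ₚ σ → rank σ ≤ rank π → π ≈ₚ σ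
  rank-strict π σ π≤σ rσ≤rπ = ≤ₚ-antisym {i = π} {σ} π≤σ (~⇒≤ₚ σ π σ⇒π)
    where
    nonLeast⇒ : ∀ {x} → NonLeast σ x → NonLeast π x
    nonLeast⇒ {zero}  (_ , () , _)
    nonLeast⇒ {suc i} σ∋ = decidable-stable (nonLeast? π (suc i)) λ π∌ → ℕ.<⇒≱
      (p⊂q⇒∣p∣<∣q∣ (nonLeasts-mono π σ π≤σ , i , ∈-comprehension⁺ (nonLeast? σ ∘ suc) σ∋ ,
        π∌ ∘ ∈-comprehension⁻ (nonLeast? π ∘ suc)))
      rσ≤rπ

    up : ∀ {x y} → π ∋ x ~ y → σ ∋ x ~ y
    up = ≤ₚ⇒~ π σ π≤σ

    σ⇒π : ∀ {x y} → σ ∋ x ~ y → π ∋ x ~ y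
    σ⇒π {x} {y} x~y with x₀ , x₀-least , x~x₀ ← least π x | y₀ , y₀-least , y~y₀ ← least π y
      with refl ← least-unique σ (x₀-least ∘ nonLeast⇒) (y₀-least ∘ nonLeast⇒)
                    (~-trans σ (~-sym σ (up x~x₀)) (~-trans σ x~y (up y~y₀)))
      = ~-trans π x~x₀ (~-sym π y~y₀)

-- The Boolean sublattice of stars.

suc∈⇒∈tail : ∀ {k} {p : Subset (suc k)} {i} → suc i ∈ p → i ∈ tail p
suc∈⇒∈tail {p = _ ∷ _} (there i∈p) = i∈p

∈tail⇒suc∈ : ∀ {k} {p : Subset (suc k)} {i} → i ∈ tail p → suc i ∈ p
∈tail⇒suc∈ {p = _ ∷ _} i∈p = there i∈p

-- `∩` and `∪` on subsets are instances of `zipWith`, so this lets `core` commute with them.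
tail-zipWith : ∀ {A : Set} {k} (_∙_ : A → A → A) (xs ys : Vec A (suc k)) →
               tail (zipWith _∙_ xs ys) ≡ zipWith _∙_ (tail xs) (tail ys)
tail-zipWith _ (_ ∷ _) (_ ∷ _) = refl

module _ {k : ℕ} where

  -- The fixed point is `zero`: a block with two distinct points must be the block of `zero`.
  IsStar : Pred (Partition (suc k)) 0ℓ
  IsStar π = ∀ {x y} → π ∋ x ~ y → x ≡ y ⊎ π ∋ zero ~ x

  -- The block of `zero` always contains `zero`, so dropping that entry loses nothing and makes
  -- every subset of `Fin k` a possible value.
  core : Partition (suc k) → Subset k
  core π = tail (block π zero)

  star : Subset k → Partition (suc k)
  star S = merge (inside ∷ S)

  star-isStar : ∀ S → IsStar (star S)
  star-isStar S x~y with merge⁻ x~y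
  ... | inj₁ x≡y      = inj₁ x≡y
  ... | inj₂ (x∈ , _) = inj₂ (merge⁺ here x∈)

  core-star : ∀ S → core (star S) ≡ S
  core-star S = ⊆-antisym
    (λ i∈ → drop-there (saturated⁻ (star S) (merge-saturated id) (∈tail⇒suc∈ i∈) here))
    (λ i∈ → suc∈⇒∈tail (merge⁺ here (there i∈)))

  core-mono : ∀ π σ → π ≤ₚ σ → core π ⊆ core σ
  core-mono π σ π≤σ i∈ = suc∈⇒∈tail (≤ₚ⇒~ π σ π≤σ (∈tail⇒suc∈ i∈))

  core-cong : ∀ π σ → π ≈ₚ σ → core π ≡ core σ
  core-cong π σ π≈σ = ⊆-antisym
    (core-mono π σ (≤ₚ-reflexive {x = π} {σ} π≈σ))
    (core-mono σ π (≤ₚ-reflexive {x = σ} {π} (≐-sym π≈σ)))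

  -- Distinct points equivalent in a star both lie in the block of `zero`, and the inclusion of
  -- cores carries that block into `σ`.
  core-reflects : ∀ π σ → IsStar π → core π ⊆ core σ → π ≤ₚ σ
  core-reflects π σ π-star core⊆ = ~⇒≤ₚ π σ λ x~y → go x~y (π-star x~y)
    where
    center : ∀ {x} → π ∋ zero ~ x → σ ∋ zero ~ x
    center {zero}  _    = ~-refl σ
    center {suc i} 0~i = ∈tail⇒suc∈ (core⊆ (suc∈⇒∈tail 0~i))

    go : ∀ {x y} → π ∋ x ~ y → x ≡ y ⊎ π ∋ zero ~ x → σ ∋ x ~ y
    go _   (inj₁ refl) = ~-refl σ
    go x~y (inj₂ 0~x)  = ~-trans σ (~-sym σ (center 0~x)) (center (~-trans π 0~x x~y))

  core-injective : ∀ π σ → IsStar π → IsStar σ → core π ≡ core σ → π ≈ₚ σ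
  core-injective π σ π-star σ-star eq = ≤ₚ-antisym {i = π} {σ}
    (core-reflects π σ π-star (⊆-reflexive eq)) (core-reflects σ π σ-star (⊆-reflexive (sym eq)))

  core-∧ : ∀ π σ → core (π ∧ₚ σ) ≡ core π ∩ core σ
  core-∧ π σ = tail-zipWith _ (block π zero) (block σ zero)

  -- Outside the block of `zero` a star has only singletons. Applied to both stars, this bounds the
  -- block of `zero` in their join by the union of the two.
  ∪-center-saturated : ∀ π → IsStar π → ∀ {S} → zero ∈ S → Saturated π (block π zero ∪ S)
  ∪-center-saturated π π-star {S} 0∈S = saturated⁺ π λ x~y x∈ → go x~y x∈ (π-star x~y)
    where
    go : ∀ {x y} → π ∋ x ~ y → x ∈ block π zero ∪ S → x ≡ y ⊎ π ∋ zero ~ x → y ∈ block π zero ∪ S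
    go x~y x∈ (inj₁ refl) = x∈
    go x~y _  (inj₂ 0~x)  = x∈p∪q⁺ (inj₁ (~-trans π 0~x x~y))

  center-∨ : ∀ π σ → IsStar π → IsStar σ → block (π ∨ₚ σ) zero ≡ block π zero ∪ block σ zero
  center-∨ π σ π-star σ-star = ⊆-antisym
    (λ 0~x → saturated⁻ (π ∨ₚ σ)
      (∨ₚ-saturated π σ (∪-center-saturated π π-star (~-refl σ))
        (subst (Saturated σ) (∪-comm _ (block π zero)) (∪-center-saturated σ σ-star (~-refl π))))
      0~x (x∈p∪q⁺ (inj₁ (~-refl π))))
    ([ ≤ₚ⇒~ π (π ∨ₚ σ) (π≤π∨σ π σ) , ≤ₚ⇒~ σ (π ∨ₚ σ) (σ≤π∨σ π σ) ]′
      ∘ x∈p∪q⁻ (block π zero) (block σ zero))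

  core-∨ : ∀ π σ → IsStar π → IsStar σ → core (π ∨ₚ σ) ≡ core π ∪ core σ
  core-∨ π σ π-star σ-star =
    trans (cong tail (center-∨ π σ π-star σ-star)) (tail-zipWith _ (block π zero) (block σ zero))

  star-isSublattice : IsSublattice (Part (suc k)) IsStar
  star-isSublattice = record
    { respects = λ {π} {σ} π≈σ π-star x~y →
        respects {π} {σ} π≈σ (π-star (≤ₚ⇒~ σ π (≤ₚ-reflexive {x = σ} {π} (≐-sym π≈σ)) x~y))
    ; ∨-closed = λ {π} {σ} π-star σ-star {x} {y} → ∨-closed {π} {σ} π-star σ-star
    ; ∧-closed = λ {π} {σ} → ∧-closed {π} {σ}
    }
    where
    respects : ∀ {π σ x y} → π ≈ₚ σ → x ≡ y ⊎ π ∋ zero ~ x → x ≡ y ⊎ σ ∋ zero ~ x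
    respects _ (inj₁ x≡y) = inj₁ x≡y
    respects {π} {σ} π≈σ (inj₂ 0~x) = inj₂ (≤ₚ⇒~ π σ (≤ₚ-reflexive {x = π} {σ} π≈σ) 0~x)

    ∧-closed : ∀ {π σ} → IsStar π → IsStar σ → IsStar (π ∧ₚ σ)
    ∧-closed {π} {σ} π-star σ-star {x} {y} x~y
      with x~πy , x~σy ← x∈p∩q⁻ (block π x) (block σ x) x~y
      with π-star x~πy | σ-star x~σy
    ... | inj₁ x≡y  | _         = inj₁ x≡y
    ... | _         | inj₁ x≡y  = inj₁ x≡y
    ... | inj₂ 0~πx | inj₂ 0~σx = inj₂ (x∈p∩q⁺ (0~πx , 0~σx))

    ∨-closed : ∀ {π σ} → IsStar π → IsStar σ → IsStar (π ∨ₚ σ)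
    -- If x is not equivalent to zero in the join, then ⁅ x ⁆ is a block of both π and σ.
    ∨-closed {π} {σ} π-star σ-star {x} {y} x~y with x ∈? block (π ∨ₚ σ) zero
    ... | yes 0~x = inj₂ 0~x
    ... | no  0≁x = inj₁ (sym (x∈⁅y⁆⇒x≡y x (saturated⁻ (π ∨ₚ σ)
      (∨ₚ-saturated π σ (isolated {π} π-star (π≤π∨σ π σ)) (isolated {σ} σ-star (σ≤π∨σ π σ)))
      x~y (x∈⁅x⁆ x))))
      where
      isolated : ∀ {ρ} → IsStar ρ → ρ ≤ₚ π ∨ₚ σ → Saturated ρ ⁅ x ⁆
      isolated {ρ} ρ-star ρ≤ = saturated⁺ ρ λ u~v u∈ → go u∈ (ρ-star u~v)
        where
        go : ∀ {u v} → u ∈ ⁅ x ⁆ → u ≡ v ⊎ ρ ∋ zero ~ u → v ∈ ⁅ x ⁆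
        go u∈ (inj₁ refl) = u∈
        go u∈ (inj₂ 0~u)  = contradiction
          (≤ₚ⇒~ ρ (π ∨ₚ σ) ρ≤ (subst (ρ ∋ zero ~_) (x∈⁅y⁆⇒x≡y x u∈) 0~u)) 0≁x

  private

    module S = IsSublattice star-isSublattice

    coreₛ : ∃ IsStar → Subset k
    coreₛ = core ∘ proj₁

    starₛ : Subset k → ∃ IsStar
    starₛ S = star S , star-isStar S

    coreₛ-injective : ∀ {p q} → coreₛ p ≡ coreₛ q → proj₁ p ≈ₚ proj₁ q
    coreₛ-injective {π , π-star} {σ , σ-star} = core-injective π σ π-star σ-star

  -- The laws are pulled back from the powerset of `Fin k` along `core`, an injective lattice
  -- homomorphism.
  star-isBooleanSublattice : IsBooleanSublattice (Part (suc k)) IsStar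
  star-isBooleanSublattice = record
    { isSublattice     = star-isSublattice
    ; complement       = starₛ ∘ ∁ ∘ coreₛ
    ; top              = starₛ ⊤
    ; bottom           = starₛ ⊥
    ; isBooleanAlgebra = record
      { isDistributiveLattice =
          LatticeMonomorphism.isDistributiveLattice core-isLatticeMonomorphism (∪-∩-isDistributiveLattice k)
      ; ∨-complement =
          (λ p → coreₛ-injective {S.join (∁ₛ p) p} {starₛ ⊤} (join-complementˡ p)) ,
          (λ p → coreₛ-injective {S.join p (∁ₛ p)} {starₛ ⊤} (join-complementʳ p))
      ; ∧-complement =
          (λ p → coreₛ-injective {S.meet (∁ₛ p) p} {starₛ ⊥} (meet-complementˡ p)) ,
          (λ p → coreₛ-injective {S.meet p (∁ₛ p)} {starₛ ⊥} (meet-complementʳ p))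
      ; ¬-cong = λ {p} {q} p≈q →
          coreₛ-injective {∁ₛ p} {∁ₛ q} (cong (coreₛ ∘ starₛ ∘ ∁) (core-cong (proj₁ p) (proj₁ q) p≈q))
      }
    }
    where
    open ≡-Reasoning

    ∁ₛ : ∃ IsStar → ∃ IsStar
    ∁ₛ = starₛ ∘ ∁ ∘ coreₛ

    join-homo : ∀ p q → coreₛ (S.join p q) ≡ coreₛ p ∪ coreₛ q
    join-homo (π , π-star) (σ , σ-star) = core-∨ π σ π-star σ-star

    meet-homo : ∀ p q → coreₛ (S.meet p q) ≡ coreₛ p ∩ coreₛ q
    meet-homo (π , _) (σ , _) = core-∧ π σ

    core-∁ : ∀ p → coreₛ (∁ₛ p) ≡ ∁ (coreₛ p)
    core-∁ p = core-star (∁ (coreₛ p))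

    join-complementˡ : ∀ p → coreₛ (S.join (∁ₛ p) p) ≡ coreₛ (starₛ ⊤)
    join-complementˡ p = begin
      coreₛ (S.join (∁ₛ p) p)     ≡⟨ join-homo (∁ₛ p) p ⟩
      coreₛ (∁ₛ p) ∪ coreₛ p      ≡⟨ cong (_∪ coreₛ p) (core-∁ p) ⟩
      ∁ (coreₛ p) ∪ coreₛ p       ≡⟨ ∪-inverseˡ (coreₛ p) ⟩
      ⊤                           ≡⟨ core-star ⊤ ⟨
      coreₛ (starₛ ⊤)             ∎

    join-complementʳ : ∀ p → coreₛ (S.join p (∁ₛ p)) ≡ coreₛ (starₛ ⊤)
    join-complementʳ p = begin
      coreₛ (S.join p (∁ₛ p))     ≡⟨ join-homo p (∁ₛ p) ⟩
      coreₛ p ∪ coreₛ (∁ₛ p)      ≡⟨ cong (coreₛ p ∪_) (core-∁ p) ⟩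
      coreₛ p ∪ ∁ (coreₛ p)       ≡⟨ ∪-inverseʳ (coreₛ p) ⟩
      ⊤                           ≡⟨ core-star ⊤ ⟨
      coreₛ (starₛ ⊤)             ∎

    meet-complementˡ : ∀ p → coreₛ (S.meet (∁ₛ p) p) ≡ coreₛ (starₛ ⊥)
    meet-complementˡ p = begin
      coreₛ (S.meet (∁ₛ p) p)     ≡⟨ meet-homo (∁ₛ p) p ⟩
      coreₛ (∁ₛ p) ∩ coreₛ p      ≡⟨ cong (_∩ coreₛ p) (core-∁ p) ⟩
      ∁ (coreₛ p) ∩ coreₛ p       ≡⟨ ∩-inverseˡ (coreₛ p) ⟩
      ⊥                           ≡⟨ core-star ⊥ ⟨
      coreₛ (starₛ ⊥)             ∎

    meet-complementʳ : ∀ p → coreₛ (S.meet p (∁ₛ p)) ≡ coreₛ (starₛ ⊥)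
    meet-complementʳ p = begin
      coreₛ (S.meet p (∁ₛ p))     ≡⟨ meet-homo p (∁ₛ p) ⟩
      coreₛ p ∩ coreₛ (∁ₛ p)      ≡⟨ cong (coreₛ p ∩_) (core-∁ p) ⟩
      coreₛ p ∩ ∁ (coreₛ p)       ≡⟨ ∩-inverseʳ (coreₛ p) ⟩
      ⊥                           ≡⟨ core-star ⊥ ⟨
      coreₛ (starₛ ⊥)             ∎

    core-isLatticeMonomorphism : IsLatticeMonomorphism
      (record { _≈_ = λ p q → proj₁ p ≈ₚ proj₁ q ; _∧_ = S.meet ; _∨_ = S.join })
      (record { _≈_ = _≡_ ; _∧_ = _∩_ ; _∨_ = _∪_ }) coreₛ
    core-isLatticeMonomorphism = record
      { isLatticeHomomorphism = record
        { isRelHomomorphism = record { cong = λ {p} {q} → core-cong (proj₁ p) (proj₁ q) }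
        ; ∧-homo            = meet-homo
        ; ∨-homo            = join-homo
        }
      ; injective = λ {p} {q} → coreₛ-injective {p} {q}
      }

  -- Up to `≈ₚ`, `core` and `star` are mutually inverse, so stars are counted by bit vectors of
  -- length `k`.
  star-hasSize : HasSize (Part (suc k)) IsStar (2 ^ k)
  star-hasSize = record
    { to        = encode ∘ coreₛ
    ; from      = starₛ ∘ decode
    ; to-cong   = λ {p} {q} p≈q → cong encode (core-cong (proj₁ p) (proj₁ q) p≈q)
    ; from-cong = λ where refl → id , id
    ; inverse   = (λ {i} {p} p≈ → from⇒to i p p≈) , (λ {p} {i} i≡ → to⇒from p i i≡)
    }
    where
    from⇒to : ∀ i p → proj₁ p ≈ₚ star (decode i) → encode (coreₛ p) ≡ i
    from⇒to i p p≈ = trans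
      (cong encode (trans (core-cong (proj₁ p) (star (decode i)) p≈) (core-star (decode i))))
      (encode∘decode {k} i)

    to⇒from : ∀ p i → i ≡ encode (coreₛ p) → star (decode i) ≈ₚ proj₁ p
    to⇒from p i refl = coreₛ-injective {starₛ (decode i)} {p}
      (trans (core-star (decode i)) (decode∘encode (coreₛ p)))

-- Restrictions in a largest Boolean sublattice.

module LargestBooleanSublattice
  {k : ℕ} (B : Pred (Partition (suc k)) 0ℓ)
  (largest : IsLargestBooleanSublattice (Part (suc k)) B)
  where

  open IsLargestBooleanSublattice largest
    using (isBooleanSublattice; size; hasSize) renaming (largest to maximal)
  open IsBooleanSublattice isBooleanSublattice
  module Size = Inverse hasSize

  𝔹 : BooleanAlgebra _ _
  𝔹 = record { isBooleanAlgebra = isBooleanAlgebra }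

  private
    -- The order on the Boolean algebra is defined through its meet; this passes from it to
    -- refinement.
    ⊑⇒≤ₚ : ∀ (π σ : Partition (suc k)) → π ≈ₚ π ∧ₚ σ → π ≤ₚ σ
    ⊑⇒≤ₚ π σ π≈ = ≤ₚ-trans {i = π} {π ∧ₚ σ} {σ} (≤ₚ-reflexive {x = π} {π ∧ₚ σ} π≈) (π∧σ≤σ π σ)

    enum : Fin size → ∃ B
    enum = Size.from

    enum-index : ∀ p → proj₁ (enum (Size.to p)) ≈ₚ proj₁ p
    enum-index p = Size.strictlyInverseʳ p

    enum-≡ : ∀ p q → Size.to p ≡ Size.to q → proj₁ p ≈ₚ proj₁ q
    enum-≡ p q eq = ≐-trans (≐-sym (enum-index p))
      (subst (λ i → proj₁ (enum i) ≈ₚ proj₁ q) (sym eq) (enum-index q))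

    ranking : Ranking 𝔹 size
    ranking = record
      { index           = Size.to
      ; enum            = enum
      ; index-cong      = λ {p} {q} → Size.to-cong {p} {q}
      ; index-injective = λ {p} {q} → enum-≡ p q
      ; index∘enum      = Size.strictlyInverseˡ
      ; rank            = rank ∘ proj₁
      ; rank-mono       = λ {(π , _)} {(σ , _)} p⊑q → rank-mono π σ (⊑⇒≤ₚ π σ p⊑q)
      ; rank-strict     = λ {(π , _)} {(σ , _)} p⊑q → rank-strict π σ (⊑⇒≤ₚ π σ p⊑q)
      }

  open RankedBooleanAlgebra ranking

  2^k≤size : 2 ^ k ≤ size
  2^k≤size = maximal IsStar star-isBooleanSublattice star-hasSize

  size≤2^⇒k≤ : ∀ {j} → size ≤ 2 ^ j → k ≤ j
  size≤2^⇒k≤ size≤ = ℕ.≮⇒≥ λ j<k → ℕ.<⇒≱ (ℕ.^-monoʳ-< 2 (s≤s (s≤s z≤n)) j<k) (ℕ.≤-trans 2^k≤size size≤)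

  k≤rank⊤∸rank⊥ : k ≤ rank (proj₁ top) ∸ rank (proj₁ bottom)
  k≤rank⊤∸rank⊥ = size≤2^⇒k≤ size≤2^rank

  -- Since `rank σ` is at most `k`, the gap is at most `k ∸ rank π`, and `c` has to make up for
  -- `rank π`. It is applied with `c = 0` to `bottom`, and with `c = 1` to an element that has
  -- nothing strictly between it and `bottom`.
  rank≤-from-gap : ∀ c (π σ : Partition (suc k)) → k ≤ c + (rank σ ∸ rank π) → rank π ≤ c
  rank≤-from-gap c π σ k≤ = ℕ.+-cancelˡ-≤ k (rank π) c (begin
    k + rank π                      ≤⟨ ℕ.+-monoˡ-≤ (rank π) k≤ ⟩
    c + (rank σ ∸ rank π) + rank π  ≤⟨ ℕ.+-monoˡ-≤ (rank π) (ℕ.+-monoʳ-≤ c (ℕ.∸-monoˡ-≤ (rank π) (rank≤ σ))) ⟩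
    c + (k ∸ rank π) + rank π       ≡⟨ ℕ.+-assoc c (k ∸ rank π) (rank π) ⟩
    c + (k ∸ rank π + rank π)       ≡⟨ cong (c +_) (ℕ.m∸n+n≡m (rank≤ π)) ⟩
    c + k                           ≡⟨ ℕ.+-comm c k ⟩
    k + c                           ∎)
    where open ℕ.≤-Reasoning

  -- The size bound forces `top` to have rank at least `k`, the maximal rank, so strictness
  -- identifies it with `indiscrete`.
  indiscrete∈B : B indiscrete
  indiscrete∈B = respects {x = proj₁ top} {indiscrete}
    (rank-strict (proj₁ top) indiscrete (≤indiscrete (proj₁ top)) (begin
      rank (indiscrete {suc k})                  ≤⟨ rank≤ indiscrete ⟩
      k                                          ≤⟨ k≤rank⊤∸rank⊥ ⟩
      rank (proj₁ top) ∸ rank (proj₁ bottom)     ≤⟨ ℕ.m∸n≤m _ (rank (proj₁ bottom)) ⟩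
      rank (proj₁ top)                           ∎))
    (proj₂ top)
    where open ℕ.≤-Reasoning

  rank-bottom : rank (proj₁ bottom) ≤ 0
  rank-bottom = rank≤-from-gap 0 (proj₁ bottom) (proj₁ top) k≤rank⊤∸rank⊥

  discrete≈ : ∀ (π : Partition (suc k)) → rank π ≤ 0 → discrete ≈ₚ π
  discrete≈ π rank≤0 = rank-strict discrete π (discrete≤ π) (ℕ.≤-trans rank≤0 z≤n)

  discrete∈B : B discrete
  discrete∈B = respects {x = proj₁ bottom} {discrete}
    (≐-sym (discrete≈ (proj₁ bottom) rank-bottom)) (proj₂ bottom)

  between : ∀ p → 1 < rank (proj₁ p) → ∃ λ q → bottom ⊏ q × q ⊏ p
  between p 1<rank with between⊎size≤ p
  ... | inj₁ q     = q
  ... | inj₂ size≤ =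
    contradiction (rank≤-from-gap 1 (proj₁ p) (proj₁ top) (size≤2^⇒k≤ size≤)) (ℕ.<⇒≱ 1<rank)

  -- Induction on the rank: `π` splits as a join of smaller `σ` and `τ` in `B`. Being finer than
  -- `π`, they have `S` saturated too, so `restrict-∨` assembles the restriction of `π` from theirs.
  restrict∈B : ∀ π {S} → B π → Saturated π S → B (restrict π S)
  restrict∈B π {S} π∈B = go π π∈B (<-wellFounded (rank π))
    where
    go : ∀ π → B π → Acc _<_ (rank π) → Saturated π S → B (restrict π S)
    go π π∈B (acc rs) s with rank π ℕ.≤? rank (restrict π S) | rank π ℕ.≤? 1
    -- The restriction refines `π`, so without a drop in rank the two agree.
    ... | yes rank≤′ | _ = respects {x = π} {restrict π S}
      (≐-sym (rank-strict (restrict π S) π (restrict≤ π S) rank≤′)) π∈B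
    -- A drop from rank at most 1 leaves rank 0, which only `discrete` has.
    ... | no  rank≰ | yes rank≤1 = respects {x = discrete} {restrict π S}
      (discrete≈ (restrict π S) (ℕ.≤-pred (ℕ.≤-trans (ℕ.≰⇒> rank≰) rank≤1))) discrete∈B
    ... | no  _     | no  rank≰1
      with (σ , σ∈B) , ⊥⊏σ , σ⊏π ← between (π , π∈B) (ℕ.≰⇒> rank≰1)
      with (τ , τ∈B) , τ⊏π , σ∨τ≈π ← split {π , π∈B} {σ , σ∈B} ⊥⊏σ σ⊏π
      = respects {x = restrict σ S ∨ₚ restrict τ S} {restrict π S}
          (≐-trans
            (restrict-∨ σ τ {S} σ-sat τ-sat)
            (restrict-cong (σ ∨ₚ τ) π S σ∨τ≈π))
          (∨-closed {x = restrict σ S} {restrict τ S}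
            (go σ σ∈B (rs (rank-< {σ , σ∈B} {π , π∈B} σ⊏π)) σ-sat)
            (go τ τ∈B (rs (rank-< {τ , τ∈B} {π , π∈B} τ⊏π)) τ-sat))
      where
      σ-sat : Saturated σ S
      σ-sat = saturated-anti σ π (⊑⇒≤ₚ σ π (proj₁ σ⊏π)) s

      τ-sat : Saturated τ S
      τ-sat = saturated-anti τ π (⊑⇒≤ₚ τ π (proj₁ τ⊏π)) s

  -- The semi-interval system of blocks.

  -- Quantifying over an enumeration of B rather than over B itself keeps 𝓘 in Set.
  𝓘 : Pred (Subset (suc k)) 0ℓ
  𝓘 A = A ≡ ⊥ ⊎ ∃ λ i → Block (proj₁ (enum i)) A

  block∈𝓘 : ∀ π {A} → B π → Block π A → 𝓘 A
  block∈𝓘 π π∈B a = inj₂ (Size.to (π , π∈B) , proj₂ (enum-index (π , π∈B)) a)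

  𝓘⇒block : ∀ {A x} → 𝓘 A → x ∈ A → ∃ λ π → B π × Block π A
  𝓘⇒block (inj₁ refl)    x∈A = contradiction x∈A ∉⊥
  𝓘⇒block (inj₂ (i , a)) _   = proj₁ (enum i) , proj₂ (enum i) , a

  block⇒merge∈B : ∀ π {A} → B π → Block π A → B (merge A)
  block⇒merge∈B π {A} π∈B a with x , x∈A ← nonempty π a =
    respects {x = restrict π A} {merge A} (restrict-block π a)
      (restrict∈B π π∈B (subst (Saturated π) (sym (block-unique π a x∈A)) (block-saturated π x)))

  𝓘⇒merge∈B : ∀ {A} → 𝓘 A → B (merge A)
  -- `merge ⊥` is by definition the restriction of `indiscrete` to `⊥`, which is vacuously
  -- saturated.
  𝓘⇒merge∈B (inj₁ refl) = restrict∈B indiscrete indiscrete∈B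
    (saturated⁺ indiscrete λ _ x∈⊥ → contradiction x∈⊥ ∉⊥)
  𝓘⇒merge∈B (inj₂ (i , a)) = block⇒merge∈B (proj₁ (enum i)) (proj₂ (enum i)) a

  ⊤∈𝓘 : 𝓘 ⊤
  ⊤∈𝓘 = subst 𝓘 (⊆-antisym (λ _ → ∈⊤) (λ {x} _ → indiscrete-~ {x = zero} {x}))
    (block∈𝓘 indiscrete indiscrete∈B (block-isBlock indiscrete zero))

  ⁅x⁆∈𝓘 : ∀ x → 𝓘 ⁅ x ⁆
  ⁅x⁆∈𝓘 x = subst 𝓘
    (⊆-antisym
      (λ x~y → subst (_∈ ⁅ x ⁆) (discrete⁻ x~y) (x∈⁅x⁆ x))
      (λ y∈ → subst (discrete ∋ x ~_) (sym (x∈⁅y⁆⇒x≡y x y∈)) (~-refl discrete)))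
    (block∈𝓘 discrete discrete∈B (block-isBlock discrete x))

  ∩∈𝓘 : ∀ {A A′} → 𝓘 A → 𝓘 A′ → 𝓘 (A ∩ A′)
  ∩∈𝓘 {A} {A′} A∈𝓘 A′∈𝓘 with nonempty? (A ∩ A′)
  -- Blocks are nonempty, so an empty intersection needs the separate alternative for `⊥` in `𝓘`.
  ... | no  empty = inj₁ (Empty-unique empty)
  ... | yes (x , x∈)
    with x∈A , x∈A′ ← x∈p∩q⁻ A A′ x∈
    with π , π∈B , a ← 𝓘⇒block A∈𝓘 x∈A | σ , σ∈B , a′ ← 𝓘⇒block A′∈𝓘 x∈A′
    = block∈𝓘 (π ∧ₚ σ) (∧-closed {x = π} {σ} π∈B σ∈B) ((x , x∈) , A , A′ , a , a′ , refl)

  ⋂∈𝓘 : ∀ {F} → All 𝓘 F → 𝓘 (⋂ F)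
  ⋂∈𝓘 []              = ⊤∈𝓘
  ⋂∈𝓘 (A∈𝓘 ∷ F⊆𝓘) = ∩∈𝓘 A∈𝓘 (⋂∈𝓘 F⊆𝓘)

  -- The join of the partitions from which `A` and `A′` come could chain on to further blocks.
  -- Joining `merge A` and `merge A′` instead leaves the union saturated, and the common point `x`
  -- connects all of it.
  ∪∈𝓘 : ∀ {A A′} → 𝓘 A → 𝓘 A′ → Nonempty (A ∩ A′) → 𝓘 (A ∪ A′)
  ∪∈𝓘 {A} {A′} A∈𝓘 A′∈𝓘 (x , x∈) with x∈A , x∈A′ ← x∈p∩q⁻ A A′ x∈ =
    subst 𝓘 (⊆-antisym
      (λ x~y → saturated⁻ J
        (∨ₚ-saturated (merge A) (merge A′) (merge-saturated (p⊆p∪q A′)) (merge-saturated (q⊆p∪q A A′)))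
        x~y (p⊆p∪q A′ x∈A))
      ([ (λ y∈A → ≤ₚ⇒~ (merge A) J (π≤π∨σ (merge A) (merge A′)) (merge⁺ x∈A y∈A))
       , (λ y∈A′ → ≤ₚ⇒~ (merge A′) J (σ≤π∨σ (merge A) (merge A′)) (merge⁺ x∈A′ y∈A′))
       ]′ ∘ x∈p∪q⁻ A A′))
    (block∈𝓘 J (∨-closed {x = merge A} {merge A′} (𝓘⇒merge∈B A∈𝓘) (𝓘⇒merge∈B A′∈𝓘))
      (block-isBlock J x))
    where
    J = merge A ∨ₚ merge A′

  𝓘-isSemiIntervalSystem : IsSemiIntervalSystem 𝓘
  𝓘-isSemiIntervalSystem = record
    { isClosureSystem = record { V∈Q = ⊤∈𝓘 ; ⋂-closed = ⋂∈𝓘 }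
    ; ∅∈I             = inj₁ refl
    ; ⁅x⁆∈I           = ⁅x⁆∈𝓘
    ; ∪-closed        = ∪∈𝓘
    }

  -- Each listed point contributes `merge` of its block, which lies in `B` and below `π`; `discrete`
  -- serves as the empty join. Running through all points recovers `π`.
  joinOfBlocks : ∀ π → 𝓓 𝓘 π → ∀ xs →
                 ∃ λ ρ → B ρ × ρ ≤ₚ π × (∀ {x y} → x ∈ₗ xs → π ∋ x ~ y → ρ ∋ x ~ y)
  joinOfBlocks π π∈𝓓 []       = discrete , discrete∈B , discrete≤ π , λ ()
  joinOfBlocks π π∈𝓓 (z ∷ xs)
    with ρ , ρ∈B , ρ≤π , blocks ← joinOfBlocks π π∈𝓓 xs =
    μ ∨ₚ ρ ,
    ∨-closed {x = μ} {ρ} (𝓘⇒merge∈B (π∈𝓓 (block-isBlock π z))) ρ∈B ,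
    ∨ₚ-least {x = μ} {ρ} {π} (merge-block≤ π (block-isBlock π z)) ρ≤π ,
    λ where
      (here refl)  z~y → ≤ₚ⇒~ μ (μ ∨ₚ ρ) (π≤π∨σ μ ρ) (merge⁺ (~-refl π) z~y)
      (there x∈xs) x~y → ≤ₚ⇒~ ρ (μ ∨ₚ ρ) (σ≤π∨σ μ ρ) (blocks x∈xs x~y)
    where
    μ = merge (block π z)

  𝓓𝓘⊆B : ∀ {π} → 𝓓 𝓘 π → B π
  𝓓𝓘⊆B {π} π∈𝓓
    with ρ , ρ∈B , ρ≤π , blocks ← joinOfBlocks π π∈𝓓 (allFin (suc k)) =
    respects {x = ρ} {π} (≤ₚ-antisym {i = ρ} {π} ρ≤π (~⇒≤ₚ π ρ (λ {x} → blocks (∈-allFin x)))) ρ∈B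

corollary1p5 : ∀ (n : ℕ) → 3 ≤ n →
    ∀ (B : Pred (Partition n) 0ℓ) → IsLargestBooleanSublattice (Part n) B →
    ∃ λ (I : Pred (Subset n) 0ℓ) → IsSemiIntervalSystem I × (B ≐ 𝓓 I)
corollary1p5 (suc k) _ B largest =
  𝓘 , 𝓘-isSemiIntervalSystem , (λ {π} π∈B a → block∈𝓘 π π∈B a) , (λ {π} → 𝓓𝓘⊆B {π})
  where open LargestBooleanSublattice B largest
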